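{- Let $m\ge2$ and $\tau\in S_m$. For a pattern $\tau$, let $\Xi(\tau)$ be the set of positive integers $r$ such that for some $n\ge1$ there is a permutation $\pi\in S_n$ of order $r$ (in the group $S_n$) all of whose powers $\pi^j$, $j\ge1$, avoid $\tau$. Then: (i) if $\tau=12\cdots m$ is the identity, $\Xi(\tau)$ equals the set of orders of elements of $S_{m-1}$; (ii) if $\tau\notin\{12\cdots m,\ m12\cdots(m-1),\ 23\cdots m1\}$, then $\Xi(\tau)=\mathbb N$; (iii) $\Xi(231)=\Xi(312)=\{1,2\}$.
   Context: Permutations $\pi\in S_n$ are identified with words $\pi(1)\cdots\pi(n)$. For $\tau\in S_m$, entries $\pi(i_1),\ldots,\pi(i_m)$ with $i_1<\cdots<i_m$ form an occurrence of $\tau$ if for all $j,l$, $\pi(i_j)<\pi(i_l)$ iff $\tau(j)<\tau(l)$; $\pi$ avoids $\tau$ if there is no occurrence. Here $m12\cdots(m-1)$ denotes the word $m,1,2,\ldots,m-1$ and $23\cdots m1$ the word $2,3,\ldots,m,1$. -}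

module Defs where

open import Data.Nat using (ℕ; zero; suc; _∸_; _≤_; _<_)
open import Data.Fin using (Fin; toℕ)
import Data.Fin as F
open import Data.Fin.Permutation using (Permutation′; _⟨$⟩ʳ_; _∘ₚ_; id; _≈_)
open import Data.Product using (Σ; ∃; _×_)
open import Function.Bundles using (_⇔_)
open import Relation.Nullary using (¬_)
open import Relation.Binary.PropositionalEquality using (_≡_)

_^ₚ_ : ∀ {n} → Permutation′ n → ℕ → Permutation′ n
π ^ₚ zero  = id
π ^ₚ suc k = π ∘ₚ (π ^ₚ k)

HasOrder : ∀ {n} → Permutation′ n → ℕ → Set
HasOrder π r = 1 ≤ r × ((π ^ₚ r) ≈ id) × (∀ k → 1 ≤ k → k < r → ¬ ((π ^ₚ k) ≈ id))

Occurs : ∀ {m n} → Permutation′ m → Permutation′ n → Set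
Occurs {m} {n} τ π =
  Σ (Fin m → Fin n) λ ι →
    (∀ j l → j F.< l → ι j F.< ι l) ×
    (∀ j l → ((π ⟨$⟩ʳ ι j) F.< (π ⟨$⟩ʳ ι l)) ⇔ ((τ ⟨$⟩ʳ j) F.< (τ ⟨$⟩ʳ l)))

Avoids : ∀ {m n} → Permutation′ n → Permutation′ m → Set
Avoids π τ = ¬ Occurs τ π

Ξ : ∀ {m} → Permutation′ m → ℕ → Set
Ξ τ r = Σ ℕ λ n → 1 ≤ n × Σ (Permutation′ n) λ π →
          HasOrder π r × (∀ j → 1 ≤ j → Avoids (π ^ₚ j) τ)

-- τ has one-line word w (values 0-indexed): τ(i) = w(i)
HasWord : ∀ {m} → Permutation′ m → (ℕ → ℕ) → Set
HasWord {m} τ w = ∀ (i : Fin m) → toℕ (τ ⟨$⟩ʳ i) ≡ w (toℕ i)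

-- 0-indexed words:
-- 12⋯m            : i ↦ i
-- m12⋯(m-1)       : 0 ↦ m-1, i+1 ↦ i
-- 23⋯m1           : i ↦ i+1 for i+1 < m, m-1 ↦ 0
wordId : ℕ → ℕ
wordId i = i

wordM12 : ℕ → ℕ → ℕ
wordM12 m zero    = m ∸ 1
wordM12 m (suc i) = i

wordTo1 : ℕ → ℕ → ℕ
wordTo1 m i with suc i Data.Nat.≟ m
... | Relation.Nullary.yes _ = 0
... | Relation.Nullary.no _  = suc i

-- For the identity pattern, the power π^r = id contains 12⋯m as soon as n ≥ m.
--
-- Every pattern inside a rotation of 12⋯n is a rotation of 12⋯m, so powers of an r-cycle that rotates
-- avoid all other patterns. A rotation of 12⋯m other than 12⋯m, m12⋯(m-1), 23⋯m1 contains 3412, and all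
-- powers of the r-cycle that runs up through the lower half 1, …, h and then down from r to h + 1
-- avoid 3412 when h = ⌊r/2⌋.
--
-- If all powers of π avoid 231 (or 312), then π and π⁻¹ do, so π avoids both 231 and 312; such
-- permutations are direct sums of decreasing ones, hence involutions.

{-# OPTIONS --safe #-}
module Submission where

open import Defs
open import Data.Nat using (ℕ; zero; suc; _+_; _∸_; _≤_; _<_; z≤n; s≤s; s≤s⁻¹; z<s; ⌊_/2⌋; ⌈_/2⌉)
open import Data.Nat.Properties
open import Data.Nat.DivMod using (_%_; m%n<n; m<n⇒m%n≡m; [m+n]%n≡m%n; %-distribˡ-+; m%n%n≡m%n; n%n≡0)
open import Data.Fin using (Fin; zero; suc; toℕ; fromℕ; fromℕ<; inject₁; inject≤)
import Data.Fin as F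
import Data.Fin.Properties as Fₚ
open import Data.Fin.Relation.Unary.Top using (view; ‵fromℕ; ‵inject₁)
open import Data.Fin.Patterns using (0F; 1F; 2F)
open import Data.Fin.Permutation using (Permutation′; permutation; _⟨$⟩ʳ_; _⟨$⟩ˡ_; _∘ₚ_; id; flip; _≈_; inverseˡ; inverseʳ; lift₀)
open import Data.Empty using (⊥)
open import Data.Product using (Σ; ∃; _×_; _,_; proj₁; proj₂)
open import Data.Sum using (_⊎_; inj₁; inj₂; [_,_]′)
open import Function.Base using (_∘_)
open import Function.Bundles using (_⇔_; mk⇔; Equivalence)
open import Function.Definitions using (Injective)
open import Relation.Binary.Definitions using (tri<; tri≈; tri>)
open import Relation.Nullary using (¬_; Dec; yes; no; contradiction; _×-dec_)
open import Relation.Binary.PropositionalEquality using (_≡_; _≢_; refl; sym; trans; cong; subst; subst₂; module ≡-Reasoning)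

private
  variable
    m n r : ℕ

-- Injectivity and monotone maps

⟨$⟩ʳ-injective : (π : Permutation′ n) → Injective _≡_ _≡_ (π ⟨$⟩ʳ_)
⟨$⟩ʳ-injective π {i} {j} eq = trans (sym (inverseˡ π)) (trans (cong (π ⟨$⟩ˡ_) eq) (inverseˡ π))

StrictlyMonotone : (Fin m → Fin n) → Set
StrictlyMonotone f = ∀ i j → i F.< j → f i F.< f j

strictlyMonotone⇒injective : {f : Fin m → Fin n} → StrictlyMonotone f → Injective _≡_ _≡_ f
strictlyMonotone⇒injective {f = f} mono {i} {j} eq with Fₚ.<-cmp i j
... | tri< i<j _ _ = contradiction (cong toℕ eq) (<⇒≢ (mono i j i<j))
... | tri≈ _ i≡j _ = i≡j
... | tri> _ _ j<i = contradiction (cong toℕ (sym eq)) (<⇒≢ (mono j i j<i))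

-- Occurrences of patterns

-- Both sides are linearly ordered and `τ` is injective, so preserving the order of values already
-- implies reflecting it. Only one direction has to be checked for each occurrence.
occurs-intro : (τ : Permutation′ m) (π : Permutation′ n) (ι : Fin m → Fin n) → StrictlyMonotone ι →
               (∀ j l → (τ ⟨$⟩ʳ j) F.< (τ ⟨$⟩ʳ l) → (π ⟨$⟩ʳ ι j) F.< (π ⟨$⟩ʳ ι l)) →
               Occurs τ π
occurs-intro τ π ι mono order = ι , mono , λ j l → mk⇔ (reflect j l) (order j l)
  where
  reflect : ∀ j l → (π ⟨$⟩ʳ ι j) F.< (π ⟨$⟩ʳ ι l) → (τ ⟨$⟩ʳ j) F.< (τ ⟨$⟩ʳ l)
  reflect j l lt with Fₚ.<-cmp (τ ⟨$⟩ʳ j) (τ ⟨$⟩ʳ l)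
  ... | tri< τ< _ _ = τ<
  ... | tri≈ _ eq _ with refl ← ⟨$⟩ʳ-injective τ eq = contradiction lt (<-irrefl refl)
  ... | tri> _ _ τ> = contradiction lt (<-asym (order l j τ>))

occurs⇒≤ : {τ : Permutation′ m} {π : Permutation′ n} → Occurs τ π → m ≤ n
occurs⇒≤ (ι , mono , _) = Fₚ.injective⇒≤ (strictlyMonotone⇒injective {f = ι} mono)

-- Four explicit positions make containment of 3412 decidable by finite search; `Ξ-generic` branches
-- on that decision.
Contains3412 : (Fin m → Fin n) → Set
Contains3412 f = ∃ λ a → ∃ λ b → ∃ λ c → ∃ λ d →
  (a F.< b × b F.< c × c F.< d) × (f c F.< f d × f d F.< f a × f a F.< f b)

contains3412? : (f : Fin m → Fin n) → Dec (Contains3412 f)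
contains3412? f = Fₚ.any? λ a → Fₚ.any? λ b → Fₚ.any? λ c → Fₚ.any? λ d →
  (a F.<? b ×-dec b F.<? c ×-dec c F.<? d) ×-dec (f c F.<? f d ×-dec f d F.<? f a ×-dec f a F.<? f b)

-- Containment is transitive. Read contrapositively, a permutation avoiding 3412 avoids every `τ`
-- that contains 3412.
occurs-3412 : {τ : Permutation′ m} {π : Permutation′ n} → Occurs τ π →
              Contains3412 (τ ⟨$⟩ʳ_) → Contains3412 (π ⟨$⟩ʳ_)
occurs-3412 (ι , mono , iff) (a , b , c , d , (a<b , b<c , c<d) , (cd , da , ab)) =
  ι a , ι b , ι c , ι d , (mono a b a<b , mono b c b<c , mono c d c<d) ,
  (Equivalence.from (iff c d) cd , Equivalence.from (iff d a) da , Equivalence.from (iff a b) ab)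

-- Orders of permutations

^ₚ-lift₀ : (π : Permutation′ n) (k : ℕ) → (lift₀ π ^ₚ k) ≈ lift₀ (π ^ₚ k)
^ₚ-lift₀ π zero zero = refl
^ₚ-lift₀ π zero (suc i) = refl
^ₚ-lift₀ π (suc k) zero = ^ₚ-lift₀ π k zero
^ₚ-lift₀ π (suc k) (suc i) = ^ₚ-lift₀ π k (suc (π ⟨$⟩ʳ i))

lift₀-hasOrder : (π : Permutation′ n) → HasOrder π r → HasOrder (lift₀ π) r
lift₀-hasOrder {r = r} π (1≤r , πʳ≈id , min) = 1≤r , lifted , λ k 1≤k k<r eq →
  min k 1≤k k<r λ i → Fₚ.suc-injective (trans (sym (^ₚ-lift₀ π k (suc i))) (eq (suc i)))
  where
  lifted : (lift₀ π ^ₚ r) ≈ id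
  lifted zero = ^ₚ-lift₀ π r zero
  lifted (suc i) = trans (^ₚ-lift₀ π r (suc i)) (cong suc (πʳ≈id i))

hasOrder-extend : (d : ℕ) (π : Permutation′ n) → HasOrder π r → Σ (Permutation′ (d + n)) λ σ → HasOrder σ r
hasOrder-extend zero π ord = π , ord
hasOrder-extend (suc d) π ord with σ , ord′ ← hasOrder-extend d π ord = lift₀ σ , lift₀-hasOrder σ ord′

-- Padding with fixed points embeds the smaller symmetric group in the larger one and keeps orders.
hasOrder-mono : n ≤ m → (π : Permutation′ n) → HasOrder π r → Σ (Permutation′ m) λ σ → HasOrder σ r
hasOrder-mono {n} {m} {r} n≤m π ord =
  subst (λ k → Σ (Permutation′ k) λ σ → HasOrder σ r) (m∸n+n≡m n≤m) (hasOrder-extend (m ∸ n) π ord)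

-- Composition is diagrammatic, so this is the map i ↦ φ⁻¹(ρ(φ(i))).
conjugate : Permutation′ n → Permutation′ n → Permutation′ n
conjugate φ ρ = φ ∘ₚ (ρ ∘ₚ flip φ)

^ₚ-conjugate : (φ ρ : Permutation′ n) (k : ℕ) → (conjugate φ ρ ^ₚ k) ≈ conjugate φ (ρ ^ₚ k)
^ₚ-conjugate φ ρ zero i = sym (inverseˡ φ)
^ₚ-conjugate φ ρ (suc k) i = trans (^ₚ-conjugate φ ρ k _)
  (cong (λ x → φ ⟨$⟩ˡ ((ρ ^ₚ k) ⟨$⟩ʳ x)) (inverseʳ φ))

conjugate-hasOrder : (φ ρ : Permutation′ n) → HasOrder ρ r → HasOrder (conjugate φ ρ) r
conjugate-hasOrder {r = r} φ ρ (1≤r , ρʳ≈id , min) = 1≤r ,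
  (λ i → trans (^ₚ-conjugate φ ρ r i) (trans (cong (φ ⟨$⟩ˡ_) (ρʳ≈id _)) (inverseˡ φ))) ,
  λ k 1≤k k<r eq → min k 1≤k k<r λ x → ⟨$⟩ʳ-injective (flip φ)
    (trans (cong (λ y → φ ⟨$⟩ˡ ((ρ ^ₚ k) ⟨$⟩ʳ y)) (sym (inverseʳ φ)))
      (trans (sym (^ₚ-conjugate φ ρ k (φ ⟨$⟩ˡ x))) (eq (φ ⟨$⟩ˡ x))))

-- The identity pattern

identity-occurs : m ≤ n → {τ : Permutation′ m} → HasWord τ wordId → {π : Permutation′ n} → π ≈ id → Occurs τ π
identity-occurs m≤n {τ} w {π} π≈id = occurs-intro τ π ι mono order
  where
  ι = λ i → inject≤ i m≤n
  toℕ-ι = λ i → Fₚ.toℕ-inject≤ i m≤n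
  mono : StrictlyMonotone ι
  mono i j = subst₂ _<_ (sym (toℕ-ι i)) (sym (toℕ-ι j))
  order : ∀ j l → (τ ⟨$⟩ʳ j) F.< (τ ⟨$⟩ʳ l) → (π ⟨$⟩ʳ ι j) F.< (π ⟨$⟩ʳ ι l)
  order j l lt = subst₂ F._<_ (sym (π≈id _)) (sym (π≈id _)) (mono j l (subst₂ _<_ (w j) (w l) lt))

Ξ-identity : 2 ≤ m → (τ : Permutation′ m) → HasWord τ wordId →
             ∀ r → Ξ τ r ⇔ Σ (Permutation′ (m ∸ 1)) (λ σ → HasOrder σ r)
Ξ-identity {suc m} (s≤s 1≤m) τ w r = mk⇔ to from
  where
  to : Ξ τ r → Σ (Permutation′ m) (λ σ → HasOrder σ r)
  -- After the match on `suc m`, the pattern has length `m + 1`, and `m` is the degree of the target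
  -- group.
  to (n , _ , π , ord@(1≤r , πʳ≈id , _) , avoids) with n ≤? m
  ... | yes n≤m = hasOrder-mono n≤m π ord
  ... | no n≰m = contradiction (identity-occurs (≰⇒> n≰m) {τ} w {π ^ₚ r} πʳ≈id) (avoids r 1≤r)
  from : Σ (Permutation′ m) (λ σ → HasOrder σ r) → Ξ τ r
  from (σ , ord) = m , 1≤m , σ , ord , λ j _ occ → 1+n≰n (occurs⇒≤ {τ = τ} {σ ^ₚ j} occ)

-- Strictly monotone permutations

-- Values rise by at least one per step. The induction runs on the numeral `k`, because `inject₁ i`
-- is not a structural subterm of `suc i`.
strictlyMonotone⇒inflationary : {f : Fin m → Fin n} → StrictlyMonotone f → ∀ k i → toℕ i ≡ k → k ≤ toℕ (f i)
strictlyMonotone⇒inflationary mono zero i eq = z≤n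
strictlyMonotone⇒inflationary mono (suc k) (suc i) eq = ≤-<-trans
  (strictlyMonotone⇒inflationary mono k (inject₁ i) (trans (Fₚ.toℕ-inject₁ i) (suc-injective eq)))
  (mono (inject₁ i) (suc i) (≤-reflexive (cong suc (Fₚ.toℕ-inject₁ i))))

strictlyMonotone⇒≈id : (π : Permutation′ n) → StrictlyMonotone (π ⟨$⟩ʳ_) → π ≈ id
strictlyMonotone⇒≈id π mono i = Fₚ.≤-antisym
  -- The inverse is monotone as well, and its inflation at π(i) gives π(i) ≤ i.
  (subst (λ j → (π ⟨$⟩ʳ i) F.≤ j) (inverseˡ π) (strictlyMonotone⇒inflationary inverse-mono _ _ refl))
  (strictlyMonotone⇒inflationary mono _ _ refl)
  where
  inverse-mono : StrictlyMonotone (π ⟨$⟩ˡ_)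
  inverse-mono i j i<j with Fₚ.<-cmp (π ⟨$⟩ˡ i) (π ⟨$⟩ˡ j)
  ... | tri< lt _ _ = lt
  ... | tri≈ _ eq _ = contradiction (cong toℕ (⟨$⟩ʳ-injective (flip π) eq)) (<⇒≢ i<j)
  ... | tri> _ _ gt = contradiction (subst₂ F._<_ (inverseʳ π) (inverseʳ π) (mono _ _ gt)) (<-asym i<j)

-- Rotations

[m%n+o]%n≡[m+o]%n : ∀ a b n → (a % suc n + b) % suc n ≡ (a + b) % suc n
[m%n+o]%n≡[m+o]%n a b n = begin
  (a % N + b) % N          ≡⟨ %-distribˡ-+ (a % N) b N ⟩
  (a % N % N + b % N) % N  ≡⟨ cong (λ x → (x + b % N) % N) (m%n%n≡m%n a N) ⟩
  (a % N + b % N) % N      ≡⟨ %-distribˡ-+ a b N ⟨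
  (a + b) % N              ∎
  where open ≡-Reasoning
        N = suc n

shift : (k : ℕ) → Fin (suc n) → Fin (suc n)
shift {n} k i = fromℕ< (m%n<n (toℕ i + k) (suc n))

toℕ-shift : ∀ k (i : Fin (suc n)) → toℕ (shift k i) ≡ (toℕ i + k) % suc n
toℕ-shift {n} k i = Fₚ.toℕ-fromℕ< (m%n<n (toℕ i + k) (suc n))

toℕ-shift-shift : ∀ k l (i : Fin (suc n)) → toℕ (shift k (shift l i)) ≡ (toℕ i + (l + k)) % suc n
toℕ-shift-shift {n} k l i = begin
  toℕ (shift k (shift l i))            ≡⟨ toℕ-shift k (shift l i) ⟩
  (toℕ (shift l i) + k) % suc n        ≡⟨ cong (λ x → (x + k) % suc n) (toℕ-shift l i) ⟩
  ((toℕ i + l) % suc n + k) % suc n    ≡⟨ [m%n+o]%n≡[m+o]%n (toℕ i + l) k n ⟩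
  (toℕ i + l + k) % suc n              ≡⟨ cong (_% suc n) (+-assoc (toℕ i) l k) ⟩
  (toℕ i + (l + k)) % suc n            ∎
  where open ≡-Reasoning

[i+n]%n≡i : (i : Fin (suc n)) → (toℕ i + suc n) % suc n ≡ toℕ i
[i+n]%n≡i {n} i = trans ([m+n]%n≡m%n (toℕ i) (suc n)) (m<n⇒m%n≡m (Fₚ.toℕ<n i))

-- The cycle i ↦ i + 1 modulo n + 1; shifting by n undoes it, since 1 + n vanishes modulo n + 1.
rotate : Permutation′ (suc n)
rotate {n} = permutation (shift 1) (shift n)
  (λ i → Fₚ.toℕ-injective (trans (toℕ-shift-shift 1 n i)
    (trans (cong (λ x → (toℕ i + x) % suc n) (+-comm n 1)) ([i+n]%n≡i i))))
  (λ i → Fₚ.toℕ-injective (trans (toℕ-shift-shift n 1 i) ([i+n]%n≡i i)))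

toℕ-rotate^ : ∀ k (i : Fin (suc n)) → toℕ ((rotate ^ₚ k) ⟨$⟩ʳ i) ≡ (toℕ i + k) % suc n
toℕ-rotate^ {n} zero i = sym (trans (cong (_% suc n) (+-identityʳ (toℕ i))) (m<n⇒m%n≡m (Fₚ.toℕ<n i)))
toℕ-rotate^ {n} (suc k) i = begin
  toℕ ((rotate ^ₚ k) ⟨$⟩ʳ shift 1 i)  ≡⟨ toℕ-rotate^ k (shift 1 i) ⟩
  (toℕ (shift 1 i) + k) % suc n       ≡⟨ toℕ-shift k (shift 1 i) ⟨
  toℕ (shift k (shift 1 i))           ≡⟨ toℕ-shift-shift k 1 i ⟩
  (toℕ i + suc k) % suc n             ∎
  where open ≡-Reasoning

rotate-hasOrder : HasOrder (rotate {n}) (suc n)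
rotate-hasOrder {n} = s≤s z≤n ,
  (λ i → Fₚ.toℕ-injective (trans (toℕ-rotate^ (suc n) i) ([i+n]%n≡i i))) ,
  -- A power `k` with 0 < k < n + 1 moves position 0 to `k`.
  λ k 1≤k k<r eq → contradiction
    (trans (sym (cong toℕ (eq zero))) (trans (toℕ-rotate^ k zero) (m<n⇒m%n≡m k<r))) (<⇒≢ 1≤k)

-- Adding `k` carries a position x across `N` exactly when `N ≤ x + s`. The shift increases on the
-- carried and on the uncarried positions separately, and every carried position lands below every
-- uncarried one.
module _ {n : ℕ} (k : ℕ) where
  private
    N = suc n
    s = k % N

    shift-mod : ∀ x → (x + k) % N ≡ (x + s) % N
    shift-mod x = trans (cong (_% N) (+-comm x k))
      (trans (sym ([m%n+o]%n≡[m+o]%n k x n)) (cong (_% N) (+-comm s x)))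

  %-unwrapped : ∀ {x} → x + s < N → (x + k) % N ≡ x + s
  %-unwrapped {x} lt = trans (shift-mod x) (m<n⇒m%n≡m lt)

  -- With `N` added back, comparisons can cancel `N` and avoid truncated subtraction.
  %-wrapped : ∀ {x} → x < N → N ≤ x + s → (x + k) % N + N ≡ x + s
  %-wrapped {x} x<N ge = trans (cong (_+ N) (trans (shift-mod x) reduced)) (m∸n+n≡m ge)
    where
    y = x + s ∸ N
    y<N : y < N
    y<N = +-cancelʳ-< N y N (subst (_< N + N) (sym (m∸n+n≡m ge)) (+-mono-< x<N (m%n<n k N)))
    reduced : (x + s) % N ≡ y
    reduced = trans (cong (_% N) (sym (m∸n+n≡m ge))) (trans ([m+n]%n≡m%n y N) (m<n⇒m%n≡m y<N))

  %-mono-wrapped : ∀ {x y} → x < y → y < N → N ≤ x + s → (x + k) % N < (y + k) % N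
  %-mono-wrapped x<y y<N ge = +-cancelʳ-< N _ _ (subst₂ _<_
    (sym (%-wrapped (<-trans x<y y<N) ge))
    (sym (%-wrapped y<N (≤-trans ge (+-monoˡ-≤ s (<⇒≤ x<y))))) (+-monoˡ-< s x<y))

  %-mono-unwrapped : ∀ {x y} → x < y → y + s < N → (x + k) % N < (y + k) % N
  %-mono-unwrapped x<y lt = subst₂ _<_
    (sym (%-unwrapped (<-trans (+-monoˡ-< s x<y) lt))) (sym (%-unwrapped lt)) (+-monoˡ-< s x<y)

  %-wrapped<unwrapped : ∀ {x y} → x + s < N → y < N → N ≤ y + s → (y + k) % N < (x + k) % N
  %-wrapped<unwrapped {x} {y} lt y<N ge = +-cancelʳ-< N _ _ (begin-strict
    (y + k) % N + N  ≡⟨ %-wrapped y<N ge ⟩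
    y + s            <⟨ +-monoˡ-< s y<N ⟩
    N + s            ≡⟨ +-comm N s ⟩
    s + N            ≤⟨ +-monoˡ-≤ N (m≤n+m s x) ⟩
    x + s + N        ≡⟨ cong (_+ N) (%-unwrapped lt) ⟨
    (x + k) % N + N  ∎)
    where open ≤-Reasoning

  -- A shift can only invert x < y by carrying y, but not x, across N.
  %-inversion : ∀ {x y} → x < y → y < N → (y + k) % N < (x + k) % N →
                y + (x + k) % N ≡ N + x + (y + k) % N
  %-inversion {x} {y} x<y y<N inv with y + s <? N | N ≤? x + s
  ... | yes lt | _ = contradiction inv (<-asym (%-mono-unwrapped x<y lt))
  ... | no _ | yes ge = contradiction inv (<-asym (%-mono-wrapped x<y y<N ge))
  ... | no y≮ | no x≱ = begin
    y + (x + k) % N      ≡⟨ cong (y +_) (%-unwrapped (≰⇒> x≱)) ⟩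
    y + (x + s)          ≡⟨ cong (y +_) (+-comm x s) ⟩
    y + (s + x)          ≡⟨ +-assoc y s x ⟨
    y + s + x            ≡⟨ cong (_+ x) (%-wrapped y<N (≮⇒≥ y≮)) ⟨
    (y + k) % N + N + x  ≡⟨ +-assoc ((y + k) % N) N x ⟩
    (y + k) % N + (N + x) ≡⟨ +-comm _ (N + x) ⟩
    N + x + (y + k) % N  ∎
    where open ≡-Reasoning

-- Words of the rotation and of its inverse

shift-last : shift 1 (fromℕ n) ≡ zero
shift-last {n} = Fₚ.toℕ-injective (begin
  toℕ (shift 1 (fromℕ n))      ≡⟨ toℕ-shift 1 (fromℕ n) ⟩
  (toℕ (fromℕ n) + 1) % suc n  ≡⟨ cong (λ x → (x + 1) % suc n) (Fₚ.toℕ-fromℕ n) ⟩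
  (n + 1) % suc n              ≡⟨ cong (_% suc n) (+-comm n 1) ⟩
  suc n % suc n                ≡⟨ n%n≡0 (suc n) ⟩
  0                            ∎)
  where open ≡-Reasoning

shift-inject₁ : (i : Fin n) → shift 1 (inject₁ i) ≡ suc i
shift-inject₁ {n} i = Fₚ.toℕ-injective (begin
  toℕ (shift 1 (inject₁ i))      ≡⟨ toℕ-shift 1 (inject₁ i) ⟩
  (toℕ (inject₁ i) + 1) % suc n  ≡⟨ cong (λ x → (x + 1) % suc n) (Fₚ.toℕ-inject₁ i) ⟩
  (toℕ i + 1) % suc n            ≡⟨ cong (_% suc n) (+-comm (toℕ i) 1) ⟩
  suc (toℕ i) % suc n            ≡⟨ m<n⇒m%n≡m (s≤s (Fₚ.toℕ<n i)) ⟩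
  suc (toℕ i)                    ∎)
  where open ≡-Reasoning

unshift-zero : rotate {n} ⟨$⟩ˡ zero ≡ fromℕ n
unshift-zero = trans (cong (rotate ⟨$⟩ˡ_) (sym shift-last)) (inverseˡ rotate)

unshift-suc : (i : Fin n) → rotate {n} ⟨$⟩ˡ suc i ≡ inject₁ i
unshift-suc i = trans (cong (rotate ⟨$⟩ˡ_) (sym (shift-inject₁ i))) (inverseˡ rotate)

wordTo1-last : ∀ {m i} → suc i ≡ m → wordTo1 m i ≡ 0
wordTo1-last {m} {i} eq with suc i ≟ m
... | yes _ = refl
... | no neq = contradiction eq neq

wordTo1-init : ∀ {m i} → suc i ≢ m → wordTo1 m i ≡ suc i
wordTo1-init {m} {i} neq with suc i ≟ m
... | yes eq = contradiction eq neq
... | no _ = refl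

-- A monotone permutation is the identity, so `τ` is the inverse of `rotate`.
rotate∘-monotone⇒wordM12 : (τ : Permutation′ (suc n)) →
  StrictlyMonotone ((rotate ∘ₚ τ) ⟨$⟩ʳ_) → HasWord τ (wordM12 (suc n))
rotate∘-monotone⇒wordM12 {n} τ mono = word
  where
  fixed : ∀ i → τ ⟨$⟩ʳ shift 1 i ≡ i
  fixed = strictlyMonotone⇒≈id (rotate ∘ₚ τ) mono
  word : HasWord τ (wordM12 (suc n))
  word zero = trans (cong toℕ (trans (cong (τ ⟨$⟩ʳ_) (sym shift-last)) (fixed (fromℕ n)))) (Fₚ.toℕ-fromℕ n)
  word (suc i) = trans (cong toℕ (trans (cong (τ ⟨$⟩ʳ_) (sym (shift-inject₁ i))) (fixed (inject₁ i)))) (Fₚ.toℕ-inject₁ i)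

-- Here `τ` cancels the inverse of `rotate`, so it is the rotation itself.
unrotate∘-monotone⇒wordTo1 : (τ : Permutation′ (suc n)) →
  StrictlyMonotone ((flip rotate ∘ₚ τ) ⟨$⟩ʳ_) → HasWord τ (wordTo1 (suc n))
unrotate∘-monotone⇒wordTo1 {n} τ mono i with view i
... | ‵fromℕ = trans (cong toℕ (trans (cong (τ ⟨$⟩ʳ_) (sym unshift-zero)) (fixed zero)))
                     (sym (wordTo1-last (cong suc (Fₚ.toℕ-fromℕ n))))
  where fixed = strictlyMonotone⇒≈id (flip rotate ∘ₚ τ) mono
... | ‵inject₁ j = trans (cong toℕ (trans (cong (τ ⟨$⟩ʳ_) (sym (unshift-suc j))) (fixed (suc j))))
                     (sym (trans (wordTo1-init (<⇒≢ (s≤s (subst (_< n) (sym (Fₚ.toℕ-inject₁ j)) (Fₚ.toℕ<n j)))))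
                                 (cong suc (Fₚ.toℕ-inject₁ j))))
  where fixed = strictlyMonotone⇒≈id (flip rotate ∘ₚ τ) mono

-- An increasing run on Low followed by a smaller increasing run on its complement:
-- unless one of the runs has at most one entry, the ends of the two runs form 3412.
two-runs : (τ : Permutation′ (2 + m)) {Low : Fin (2 + m) → Set} →
  (∀ j → Dec (Low j)) →
  (∀ {j l} → j F.≤ l → Low l → Low j) →
  (∀ {j l} → j F.< l → Low l → (τ ⟨$⟩ʳ j) F.< (τ ⟨$⟩ʳ l)) →
  (∀ {j l} → j F.< l → ¬ Low j → (τ ⟨$⟩ʳ j) F.< (τ ⟨$⟩ʳ l)) →
  (∀ {j l} → Low j → ¬ Low l → (τ ⟨$⟩ʳ l) F.< (τ ⟨$⟩ʳ j)) →
  Contains3412 (τ ⟨$⟩ʳ_) ⊎ HasWord τ wordId ⊎ HasWord τ (wordM12 (2 + m)) ⊎ HasWord τ (wordTo1 (2 + m))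
two-runs {m} τ {Low} low? down inc-low inc-high cross
  -- By `down`, `Low` is an initial segment, so the first two and last two positions reveal whether
  -- a run has at most one entry.
  with low? zero | low? (suc zero) | low? (inject₁ (fromℕ m)) | low? (fromℕ (suc m))
... | no high₀ | _ | _ | _ = inj₂ (inj₁ λ i → cong toℕ (strictlyMonotone⇒≈id τ
      (λ j l j<l → inc-high j<l (λ low → high₀ (down z≤n low))) i))
... | yes _ | _ | _ | yes low-last = inj₂ (inj₁ λ i → cong toℕ (strictlyMonotone⇒≈id τ
      (λ j l j<l → inc-low j<l (down (Fₚ.≤fromℕ l) low-last)) i))
-- Only position 0 is low; moving its entry to the end makes the word increasing.
... | yes low₀ | no high₁ | _ | no _ = inj₂ (inj₂ (inj₁ (rotate∘-monotone⇒wordM12 τ mono)))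
  where
  high : ∀ i → ¬ Low (suc i)
  high i low = high₁ (down (s≤s z≤n) low)
  mono : StrictlyMonotone ((rotate ∘ₚ τ) ⟨$⟩ʳ_)
  mono i j i<j with view i | view j
  ... | ‵fromℕ | _ = contradiction (Fₚ.≤fromℕ j) (<⇒≱ i<j)
  ... | ‵inject₁ i′ | ‵fromℕ rewrite shift-last {suc m} | shift-inject₁ i′ = cross low₀ (high i′)
  ... | ‵inject₁ i′ | ‵inject₁ j′ rewrite shift-inject₁ i′ | shift-inject₁ j′ =
    inc-high (s≤s (subst₂ _<_ (Fₚ.toℕ-inject₁ i′) (Fₚ.toℕ-inject₁ j′) i<j)) (high i′)
-- Only the last position is high; moving its entry to the front makes the word increasing.
... | yes _ | yes _ | yes low-penult | no high-last = inj₂ (inj₂ (inj₂ (unrotate∘-monotone⇒wordTo1 τ mono)))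
  where
  low : ∀ i → Low (inject₁ i)
  low i = down (subst₂ _≤_ (sym (Fₚ.toℕ-inject₁ i)) (sym (Fₚ.toℕ-inject₁ (fromℕ m))) (Fₚ.≤fromℕ i)) low-penult
  mono : StrictlyMonotone ((flip rotate ∘ₚ τ) ⟨$⟩ʳ_)
  mono zero (suc j) _ = subst₂ (λ x y → (τ ⟨$⟩ʳ x) F.< (τ ⟨$⟩ʳ y))
    (sym unshift-zero) (sym (unshift-suc j)) (cross (low j) high-last)
  mono (suc i) (suc j) (s≤s i<j) = subst₂ (λ x y → (τ ⟨$⟩ʳ x) F.< (τ ⟨$⟩ʳ y))
    (sym (unshift-suc i)) (sym (unshift-suc j))
    (inc-low (subst₂ _<_ (sym (Fₚ.toℕ-inject₁ i)) (sym (Fₚ.toℕ-inject₁ j)) i<j) (low j))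
... | yes _ | yes low₁ | no high-penult | no high-last = inj₁
  (zero , suc zero , inject₁ (fromℕ m) , fromℕ (suc m) ,
   (z<s , ≰⇒> (λ le → high-penult (down le low₁)) , penult<last) ,
   (inc-high penult<last high-penult , cross (down z≤n low₁) high-last , inc-low z<s low₁))
  where
  penult<last : inject₁ (fromℕ m) F.< fromℕ (suc m)
  penult<last = s≤s (≤-reflexive (Fₚ.toℕ-inject₁ (fromℕ m)))

-- The two runs of the rotation are inherited by the occurrence: `Low` holds at the entries whose
-- positions are not carried across n + 1.
rotation-patterns : (τ : Permutation′ (2 + m)) (k : ℕ) → Occurs τ (rotate {n} ^ₚ k) →
  Contains3412 (τ ⟨$⟩ʳ_) ⊎ HasWord τ wordId ⊎ HasWord τ (wordM12 (2 + m)) ⊎ HasWord τ (wordTo1 (2 + m))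
rotation-patterns {m} {n} τ k (ι , mono , iff) = two-runs τ
  (λ j → toℕ (ι j) + k % suc n <? suc n)
  (λ le low → ≤-<-trans (+-monoˡ-≤ (k % suc n) (ι-mono-≤ le)) low)
  (λ lt low → reflect (%-mono-unwrapped k (mono _ _ lt) low))
  (λ lt high → reflect (%-mono-wrapped k (mono _ _ lt) (Fₚ.toℕ<n _) (≮⇒≥ high)))
  (λ low high → reflect (%-wrapped<unwrapped k low (Fₚ.toℕ<n _) (≮⇒≥ high)))
  where
  reflect : ∀ {j l} → (toℕ (ι j) + k) % suc n < (toℕ (ι l) + k) % suc n → (τ ⟨$⟩ʳ j) F.< (τ ⟨$⟩ʳ l)
  reflect {j} {l} lt = Equivalence.to (iff j l) (subst₂ _<_ (sym (toℕ-rotate^ k (ι j))) (sym (toℕ-rotate^ k (ι l))) lt)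
  ι-mono-≤ : ∀ {j l} → j F.≤ l → ι j F.≤ ι l
  ι-mono-≤ {j} {l} j≤l with m≤n⇒m<n∨m≡n j≤l
  ... | inj₁ j<l = <⇒≤ (mono j l j<l)
  ... | inj₂ j≡l = ≤-reflexive (cong (toℕ ∘ ι) (Fₚ.toℕ-injective j≡l))

-- Folded rotations

-- A rotation conjugated by the involution fold, which reverses the final segment [h, n]. The cycle
-- thus climbs through the lower half and comes back down through the upper half.
module Folded (n h : ℕ) (2h≤N : h + h ≤ suc n) (N≤2h+1 : suc n ≤ suc (h + h)) where
  private
    N = suc n

    reflected< : ∀ {x} → h ≤ x → n + h ∸ x < N
    reflected< {x} h≤x = s≤s (≤-trans (∸-monoʳ-≤ (n + h) h≤x) (≤-reflexive (m+n∸n≡m n h)))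

  fold : Fin N → Fin N
  fold i with h ≤? toℕ i
  ... | yes h≤i = fromℕ< (reflected< h≤i)
  ... | no _ = i

  fold-low : ∀ {i} → toℕ i < h → fold i ≡ i
  fold-low {i} i<h with h ≤? toℕ i
  ... | yes h≤i = contradiction i<h (≤⇒≯ h≤i)
  ... | no _ = refl

  -- The reflection x ↦ n + h - x in additive form, so that order arguments can cancel.
  toℕ-fold-high : ∀ {i} → h ≤ toℕ i → toℕ (fold i) + toℕ i ≡ n + h
  toℕ-fold-high {i} h≤i with h ≤? toℕ i
  ... | yes h≤i′ = trans (cong (_+ toℕ i) (Fₚ.toℕ-fromℕ< (reflected< h≤i′)))
                         (m∸n+n≡m (≤-trans (s≤s⁻¹ (Fₚ.toℕ<n i)) (m≤m+n n h)))
  ... | no h≰i = contradiction h≤i h≰i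

  fold-high : ∀ {i} → h ≤ toℕ i → h ≤ toℕ (fold i)
  fold-high {i} h≤i = +-cancelˡ-≤ n h _ (begin
    n + h                  ≡⟨ toℕ-fold-high h≤i ⟨
    toℕ (fold i) + toℕ i   ≤⟨ +-monoʳ-≤ (toℕ (fold i)) (s≤s⁻¹ (Fₚ.toℕ<n i)) ⟩
    toℕ (fold i) + n       ≡⟨ +-comm _ n ⟩
    n + toℕ (fold i)       ∎)
    where open ≤-Reasoning

  fold-involutive : ∀ i → fold (fold i) ≡ i
  fold-involutive i with h ≤? toℕ i
  ... | no h≰i = fold-low (≰⇒> h≰i)
  ... | yes h≤i = Fₚ.toℕ-injective (+-cancelʳ-≡ (toℕ j) _ _ (begin
      toℕ (fold j) + toℕ j  ≡⟨ toℕ-fold-high h≤j ⟩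
      n + h                 ≡⟨ m+[n∸m]≡n i≤n+h ⟨
      toℕ i + (n + h ∸ toℕ i) ≡⟨ cong (toℕ i +_) toℕ-j ⟨
      toℕ i + toℕ j         ∎))
    where
    open ≡-Reasoning
    j = fromℕ< (reflected< h≤i)
    toℕ-j : toℕ j ≡ n + h ∸ toℕ i
    toℕ-j = Fₚ.toℕ-fromℕ< (reflected< h≤i)
    i≤n : toℕ i ≤ n
    i≤n = s≤s⁻¹ (Fₚ.toℕ<n i)
    i≤n+h : toℕ i ≤ n + h
    i≤n+h = ≤-trans i≤n (m≤m+n n h)
    h≤j : h ≤ toℕ j
    h≤j = subst (h ≤_) (sym toℕ-j) (≤-trans (≤-reflexive (sym (m+n∸m≡n n h))) (∸-monoʳ-≤ (n + h) i≤n))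

  fold-antitone : ∀ {i j} → h ≤ toℕ i → i F.< j → fold j F.< fold i
  fold-antitone {i} {j} h≤i i<j = +-cancelʳ-< (toℕ i) _ _ (begin-strict
    toℕ (fold j) + toℕ i  <⟨ +-monoʳ-< (toℕ (fold j)) i<j ⟩
    toℕ (fold j) + toℕ j  ≡⟨ toℕ-fold-high (≤-trans h≤i (<⇒≤ i<j)) ⟩
    n + h                 ≡⟨ toℕ-fold-high h≤i ⟨
    toℕ (fold i) + toℕ i  ∎)
    where open ≤-Reasoning

  foldₚ : Permutation′ N
  foldₚ = permutation fold fold fold-involutive fold-involutive

  folded : Permutation′ N
  folded = conjugate foldₚ rotate

  folded-hasOrder : HasOrder folded N
  folded-hasOrder = conjugate-hasOrder foldₚ rotate rotate-hasOrder

  module _ (k : ℕ) where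
    private
      π : Fin N → Fin N
      π = (folded ^ₚ k) ⟨$⟩ʳ_

    -- In folded coordinates the power is addition of `k` modulo `N`, which makes `%-inversion`
    -- applicable.
    fold-folded^ : ∀ i → toℕ (fold (π i)) ≡ (toℕ (fold i) + k) % N
    fold-folded^ i = begin
      toℕ (fold (π i))                                    ≡⟨ cong (toℕ ∘ fold) (^ₚ-conjugate foldₚ rotate k i) ⟩
      toℕ (fold (fold ((rotate ^ₚ k) ⟨$⟩ʳ fold i)))       ≡⟨ cong toℕ (fold-involutive _) ⟩
      toℕ ((rotate ^ₚ k) ⟨$⟩ʳ fold i)                     ≡⟨ toℕ-rotate^ k (fold i) ⟩
      (toℕ (fold i) + k) % N                              ∎
      where open ≡-Reasoning

    -- An inverted pair of the cycle has gaps adding up to N before and after the rotation;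
    -- p and q bound the upper ends of the two gaps.
    no-inversion : ∀ {i j} p q → fold i F.< fold j → fold (π j) F.< fold (π i) →
                   toℕ (fold j) < p → toℕ (fold (π i)) < q →
                   p + q ≤ suc (N + toℕ (fold i) + toℕ (fold (π j))) → ⊥
    -- The strict bounds force `p + q` to be at least y + x′ + 2, while the inversion identity
    -- allows at most y + x′ + 1. The extra one in the hypothesis serves `high-no-descent` when `N`
    -- is odd.
    no-inversion {i} {j} p q x<y y′<x′ y<p x′<q p+q≤ = 1+n≰n (begin
      2 + (y + x′)         ≡⟨ cong suc (+-suc y x′) ⟨
      suc y + suc x′       ≤⟨ +-mono-≤ y<p x′<q ⟩
      p + q                ≤⟨ p+q≤ ⟩
      suc (N + x + y′)     ≡⟨ cong suc inversion ⟨
      suc (y + x′)         ∎)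
      where
      open ≤-Reasoning
      x = toℕ (fold i)
      y = toℕ (fold j)
      x′ = toℕ (fold (π i))
      y′ = toℕ (fold (π j))
      inversion : y + x′ ≡ N + x + y′
      inversion = subst₂ (λ u v → y + u ≡ N + x + v) (sym (fold-folded^ i)) (sym (fold-folded^ j))
        (%-inversion k x<y (Fₚ.toℕ<n (fold j)) (subst₂ _<_ (fold-folded^ j) (fold-folded^ i) y′<x′))

    private
      low-< : ∀ {i j} → i F.< j → toℕ j < h → fold i F.< fold j
      low-< i<j j<h = subst₂ F._<_ (sym (fold-low (<-trans i<j j<h))) (sym (fold-low j<h)) i<j

      fold<h : ∀ {i} → toℕ i < h → toℕ (fold i) < h
      fold<h i<h = subst (λ x → toℕ x < h) (sym (fold-low i<h)) i<h

    -- If π(i) were high, folding would reverse the two images and create an inversion. Its upper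
    -- ends lie below `h` and `N`, but its lower image is at least `h`, so the gaps are too short.
    low⇒low : ∀ {i j} → i F.< j → toℕ j < h → π i F.< π j → toℕ (π i) < h
    low⇒low {i} {j} i<j j<h i′<j′ = ≰⇒> λ h≤i′ → no-inversion {i} {j} h N
      (low-< i<j j<h) (fold-antitone h≤i′ i′<j′) (fold<h j<h) (Fₚ.toℕ<n _)
      (m≤n⇒m≤1+n (begin
        h + N                     ≡⟨ +-comm h N ⟩
        N + h                     ≤⟨ +-mono-≤ (m≤m+n N (toℕ (fold i))) (fold-high (≤-trans h≤i′ (<⇒≤ i′<j′))) ⟩
        N + toℕ (fold i) + toℕ (fold (π j)) ∎))
      where open ≤-Reasoning

    -- The mirror case: with π(j) low, folding reverses the positions and keeps the order of the
    -- images.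
    high⇒high : ∀ {i j} → i F.< j → h ≤ toℕ i → π i F.< π j → h ≤ toℕ (π j)
    high⇒high {i} {j} i<j h≤i i′<j′ = ≮⇒≥ λ j′<h → no-inversion {j} {i} N h
      (fold-antitone h≤i i<j) (low-< i′<j′ j′<h) (Fₚ.toℕ<n _) (fold<h j′<h)
      (m≤n⇒m≤1+n (≤-trans (+-monoʳ-≤ N (fold-high (≤-trans h≤i (<⇒≤ i<j)))) (m≤m+n _ _)))

    -- The gaps of an inversion total `N`, but two gaps inside the lower half total less than 2h ≤
    -- N.
    low-no-descent : ∀ {i j} → i F.< j → toℕ j < h → π j F.< π i → toℕ (π i) < h → ⊥
    low-no-descent {i} {j} i<j j<h j′<i′ i′<h = no-inversion {i} {j} h h
      (low-< i<j j<h) (low-< j′<i′ i′<h) (fold<h j<h) (fold<h i′<h)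
      (m≤n⇒m≤1+n (≤-trans 2h≤N (≤-trans (m≤m+n N _) (m≤m+n _ _))))

    -- Gaps inside the upper half are at most n - h each, and N ≤ 2h + 1 keeps their total below
    -- `N`.
    high-no-descent : ∀ {i j} → i F.< j → h ≤ toℕ i → π j F.< π i → h ≤ toℕ (π j) → ⊥
    high-no-descent {i} {j} i<j h≤i j′<i′ h≤j′ = no-inversion {j} {i} N N
      (fold-antitone h≤i i<j) (fold-antitone h≤j′ j′<i′) (Fₚ.toℕ<n _) (Fₚ.toℕ<n _)
      (begin
        N + N                  ≤⟨ +-monoʳ-≤ N N≤2h+1 ⟩
        N + suc (h + h)        ≡⟨ +-suc N (h + h) ⟩
        suc (N + (h + h))      ≡⟨ cong suc (+-assoc N h h) ⟨
        suc (N + h + h)        ≤⟨ s≤s (+-mono-≤ (+-monoʳ-≤ N (fold-high (≤-trans h≤i (<⇒≤ i<j)))) (fold-high (≤-trans h≤j′ (<⇒≤ j′<i′)))) ⟩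
        suc (N + toℕ (fold j) + toℕ (fold (π i))) ∎)
      where open ≤-Reasoning

    folded-avoids-3412 : ¬ Contains3412 π
    folded-avoids-3412 (a , b , c , d , (a<b , b<c , c<d) , (c′<d′ , d′<a′ , a′<b′)) =
      [ b-high , b-low ]′ (≤-<-connex h (toℕ b))
      where
      b-high : ¬ h ≤ toℕ b
      -- Then c and d are high too, the ascent at c, d makes π(d) high, and b, d is a forbidden
      -- descent.
      b-high h≤b = high-no-descent {b} {d} (<-trans b<c c<d) h≤b (<-trans d′<a′ a′<b′)
        (high⇒high {c} {d} c<d (≤-trans h≤b (<⇒≤ b<c)) c′<d′)
      b-low : ¬ toℕ b < h
      -- The ascent at a, b makes π(a) low. A high c would make π(d) high although π(d) < π(a), so c
      -- is low and a, c is a forbidden descent.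
      b-low b<h = low-no-descent {a} {c} (<-trans a<b b<c) (≰⇒> h≰c) (<-trans c′<d′ d′<a′) a′<h
        where
        a′<h : toℕ (π a) < h
        a′<h = low⇒low {a} {b} a<b b<h a′<b′
        h≰c : ¬ h ≤ toℕ c
        h≰c h≤c = <⇒≱ (<-trans d′<a′ a′<h) (high⇒high {c} {d} c<d h≤c c′<d′)

-- Patterns realizing every order

Ξ-generic : 2 ≤ m → (τ : Permutation′ m) →
            ¬ HasWord τ wordId × ¬ HasWord τ (wordM12 m) × ¬ HasWord τ (wordTo1 m) →
            ∀ r → Ξ τ r ⇔ 1 ≤ r
Ξ-generic {suc (suc m)} (s≤s (s≤s _)) τ (¬id , ¬M12 , ¬To1) r = mk⇔ (λ (_ , _ , _ , (1≤r , _) , _) → 1≤r) (from r)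
  where
  from : ∀ r → 1 ≤ r → Ξ τ r
  -- In both cases the witness is a full cycle on `r` points: the folded one if `τ` contains 3412,
  -- the plain rotation otherwise.
  from (suc n) 1≤r with contains3412? (τ ⟨$⟩ʳ_)
  ... | no ¬3412 = suc n , 1≤r , rotate , rotate-hasOrder , λ j _ occ → absurd (rotation-patterns τ j occ)
    where
    absurd : Contains3412 (τ ⟨$⟩ʳ_) ⊎ HasWord τ wordId ⊎ HasWord τ (wordM12 (2 + m)) ⊎ HasWord τ (wordTo1 (2 + m)) → ⊥
    absurd (inj₁ p) = ¬3412 p
    absurd (inj₂ (inj₁ p)) = ¬id p
    absurd (inj₂ (inj₂ (inj₁ p))) = ¬M12 p
    absurd (inj₂ (inj₂ (inj₂ p))) = ¬To1 p
  ... | yes 3412∈τ = suc n , 1≤r , folded , folded-hasOrder ,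
      λ j _ occ → folded-avoids-3412 j (occurs-3412 {τ = τ} {folded ^ₚ j} occ 3412∈τ)
    where
    h = ⌊ suc n /2⌋
    2h≤N : h + h ≤ suc n
    2h≤N = ≤-trans (+-monoʳ-≤ h (⌊n/2⌋≤⌈n/2⌉ (suc n))) (≤-reflexive (⌊n/2⌋+⌈n/2⌉≡n (suc n)))
    N≤2h+1 : suc n ≤ suc (h + h)
    N≤2h+1 = begin
      suc n            ≡⟨ ⌊n/2⌋+⌈n/2⌉≡n (suc n) ⟨
      h + ⌈ suc n /2⌉  ≤⟨ +-monoʳ-≤ h (s≤s (⌊n/2⌋-mono (n≤1+n n))) ⟩
      h + suc h        ≡⟨ +-suc h h ⟩
      suc (h + h)      ∎
      where open ≤-Reasoning
    open Folded n h 2h≤N N≤2h+1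

-- Permutations avoiding 231 and 312

Avoids231 : (Fin n → Fin n) → Set
Avoids231 f = ∀ i j k → i F.< j → j F.< k → f k F.< f i → f i F.< f j → ⊥

Avoids312 : (Fin n → Fin n) → Set
Avoids312 f = ∀ i j k → i F.< j → j F.< k → f j F.< f k → f k F.< f i → ⊥

-- Inversion exchanges positions with values and thereby turns 231 into 312.
inverse-avoids231 : (π : Permutation′ n) → Avoids312 (π ⟨$⟩ʳ_) → Avoids231 (π ⟨$⟩ˡ_)
inverse-avoids231 π av i j k i<j j<k σk<σi σi<σj = av (π ⟨$⟩ˡ k) (π ⟨$⟩ˡ i) (π ⟨$⟩ˡ j) σk<σi σi<σj
  (subst₂ F._<_ (sym (inverseʳ π)) (sym (inverseʳ π)) i<j)
  (subst₂ F._<_ (sym (inverseʳ π)) (sym (inverseʳ π)) j<k)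

inverse-avoids312 : (π : Permutation′ n) → Avoids231 (π ⟨$⟩ʳ_) → Avoids312 (π ⟨$⟩ˡ_)
inverse-avoids312 π av i j k i<j j<k σj<σk σk<σi = av (π ⟨$⟩ˡ j) (π ⟨$⟩ˡ k) (π ⟨$⟩ˡ i) σj<σk σk<σi
  (subst₂ F._<_ (sym (inverseʳ π)) (sym (inverseʳ π)) i<j)
  (subst₂ F._<_ (sym (inverseʳ π)) (sym (inverseʳ π)) j<k)

-- An injection of [i, a] into [i, b] compares their lengths; subtracting i turns both intervals
-- into initial segments.
interval-pigeonhole : {f : Fin n → Fin n} → Injective _≡_ _≡_ f → {i a b : Fin n} → i F.≤ a → i F.≤ b →
  (∀ v → i F.≤ v → v F.≤ a → i F.≤ f v × f v F.≤ b) → a F.≤ b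
interval-pigeonhole {n} {f} inj {i} {a} {b} i≤a i≤b maps = begin
  toℕ a                    ≡⟨ m+[n∸m]≡n i≤a ⟨
  toℕ i + (toℕ a ∸ toℕ i)  ≤⟨ +-monoʳ-≤ (toℕ i) (s≤s⁻¹ (Fₚ.injective⇒≤ g-injective)) ⟩
  toℕ i + (toℕ b ∸ toℕ i)  ≡⟨ m+[n∸m]≡n i≤b ⟩
  toℕ b                    ∎
  where
  open ≤-Reasoning
  i+x≤a : (x : Fin (suc (toℕ a ∸ toℕ i))) → toℕ i + toℕ x ≤ toℕ a
  i+x≤a x = ≤-trans (+-monoʳ-≤ (toℕ i) (s≤s⁻¹ (Fₚ.toℕ<n x))) (≤-reflexive (m+[n∸m]≡n i≤a))
  v : Fin (suc (toℕ a ∸ toℕ i)) → Fin n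
  v x = fromℕ< (≤-<-trans (i+x≤a x) (Fₚ.toℕ<n a))
  toℕ-v : ∀ x → toℕ (v x) ≡ toℕ i + toℕ x
  toℕ-v x = Fₚ.toℕ-fromℕ< (≤-<-trans (i+x≤a x) (Fₚ.toℕ<n a))
  bounds : ∀ x → i F.≤ f (v x) × f (v x) F.≤ b
  bounds x = maps (v x) (subst (toℕ i ≤_) (sym (toℕ-v x)) (m≤m+n _ _)) (subst (_≤ toℕ a) (sym (toℕ-v x)) (i+x≤a x))
  g< : ∀ x → toℕ (f (v x)) ∸ toℕ i < suc (toℕ b ∸ toℕ i)
  g< x = s≤s (∸-monoˡ-≤ (toℕ i) (proj₂ (bounds x)))
  g : Fin (suc (toℕ a ∸ toℕ i)) → Fin (suc (toℕ b ∸ toℕ i))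
  g x = fromℕ< (g< x)
  g-injective : Injective _≡_ _≡_ g
  g-injective {x} {y} eq = Fₚ.toℕ-injective (+-cancelˡ-≡ (toℕ i) _ _
    (trans (sym (toℕ-v x)) (trans (cong toℕ (inj fv≡)) (toℕ-v y))))
    where
    fv≡ : f (v x) ≡ f (v y)
    fv≡ = Fₚ.toℕ-injective (∸-cancelʳ-≡ (proj₁ (bounds x)) (proj₁ (bounds y))
      (trans (sym (Fₚ.toℕ-fromℕ< (g< x))) (trans (cong toℕ eq) (Fₚ.toℕ-fromℕ< (g< y)))))

-- The values in [i, π i] occupy positions in [i, π⁻¹ i].
image≤preimage : (π : Permutation′ n) → Avoids231 (π ⟨$⟩ʳ_) → Avoids312 (π ⟨$⟩ʳ_) →
  ∀ {i} → i F.< (π ⟨$⟩ʳ i) → i F.< (π ⟨$⟩ˡ i) → (π ⟨$⟩ʳ i) F.≤ (π ⟨$⟩ˡ i)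
image≤preimage π av231 av312 {i} i<a i<b =
  interval-pigeonhole (⟨$⟩ʳ-injective (flip π)) (<⇒≤ i<a) (<⇒≤ i<b)
    λ v i≤v v≤a → ≮⇒≥ (not-before v i≤v v≤a) , ≮⇒≥ (not-after v i≤v v≤a)
  where
  a = π ⟨$⟩ʳ i
  b = π ⟨$⟩ˡ i
  i<v-at : ∀ v → i F.≤ v → (π ⟨$⟩ˡ v) ≢ b → i F.< v
  i<v-at v i≤v neq = Fₚ.≤∧≢⇒< i≤v λ i≡v → neq (cong (π ⟨$⟩ˡ_) (sym i≡v))
  v<a-at : ∀ v → v F.≤ a → (π ⟨$⟩ˡ v) ≢ i → v F.< a
  v<a-at v v≤a neq = Fₚ.≤∧≢⇒< v≤a λ v≡a → neq (trans (cong (π ⟨$⟩ˡ_) v≡a) (inverseˡ π))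
  not-before : ∀ v → i F.≤ v → v F.≤ a → ¬ (π ⟨$⟩ˡ v) F.< i
  -- At positions p < i < b, with p = π⁻¹(v), the entries v, a, i would form 231.
  not-before v i≤v v≤a p<i = av231 (π ⟨$⟩ˡ v) i b p<i i<b
    (subst₂ F._<_ (sym (inverseʳ π)) (sym (inverseʳ π)) (i<v-at v i≤v (Fₚ.<⇒≢ (<-trans p<i i<b))))
    (subst (F._< a) (sym (inverseʳ π)) (v<a-at v v≤a (Fₚ.<⇒≢ p<i)))
  not-after : ∀ v → i F.≤ v → v F.≤ a → ¬ b F.< (π ⟨$⟩ˡ v)
  -- At positions i < b < p the entries a, i, v would form 312.
  not-after v i≤v v≤a b<p = av312 i b (π ⟨$⟩ˡ v) i<b b<p
    (subst₂ F._<_ (sym (inverseʳ π)) (sym (inverseʳ π)) (i<v-at v i≤v (Fₚ.<⇒≢ b<p ∘ sym)))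
    (subst (F._< a) (sym (inverseʳ π)) (v<a-at v v≤a (Fₚ.<⇒≢ (<-trans i<b b<p) ∘ sym)))

-- Strong induction on i, with `N` as a bound. If π(i) or π⁻¹(i) lies below i, the claim transfers
-- along the orbit; if both lie above, `image≤preimage` for π and for π⁻¹ gives π(i) = π⁻¹(i).
avoids231∧312⇒involutive : (π : Permutation′ n) → Avoids231 (π ⟨$⟩ʳ_) → Avoids312 (π ⟨$⟩ʳ_) → ∀ i → π ⟨$⟩ʳ (π ⟨$⟩ʳ i) ≡ i
avoids231∧312⇒involutive {n} π av231 av312 i = go n i (Fₚ.toℕ<n i)
  where
  f = π ⟨$⟩ʳ_
  σ = π ⟨$⟩ˡ_
  go : ∀ N i → toℕ i < N → f (f i) ≡ i
  go (suc N) i (s≤s i≤N) with Fₚ.<-cmp (f i) i | Fₚ.<-cmp (σ i) i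
  ... | tri< fi<i _ _ | _ = ⟨$⟩ʳ-injective π (go N (f i) (<-≤-trans fi<i i≤N))
  ... | tri≈ _ fi≡i _ | _ = trans (cong f fi≡i) fi≡i
  ... | tri> _ _ _ | tri< σi<i _ _ =
    trans (cong f (trans (cong f (sym (inverseʳ π))) (go N (σ i) (<-≤-trans σi<i i≤N)))) (inverseʳ π)
  ... | tri> _ _ _ | tri≈ _ σi≡i _ = trans (cong f fi≡i) fi≡i
    where
    fi≡i : f i ≡ i
    fi≡i = trans (cong f (sym σi≡i)) (inverseʳ π)
  ... | tri> _ _ i<fi | tri> _ _ i<σi = trans (cong f fi≡σi) (inverseʳ π)
    where
    fi≡σi : f i ≡ σ i
    fi≡σi = Fₚ.≤-antisym (image≤preimage π av231 av312 i<fi i<σi)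
      (image≤preimage (flip π) (inverse-avoids231 π av312) (inverse-avoids312 π av231) i<σi i<fi)

-- Orders for the patterns 231 and 312

pick₃ : Fin n → Fin n → Fin n → Fin 3 → Fin n
pick₃ i j k 0F = i
pick₃ i j k 1F = j
pick₃ i j k 2F = k

pick₃-strictlyMonotone : {i j k : Fin n} → i F.< j → j F.< k → StrictlyMonotone (pick₃ i j k)
pick₃-strictlyMonotone i<j j<k 0F 1F _ = i<j
pick₃-strictlyMonotone i<j j<k 0F 2F _ = <-trans i<j j<k
pick₃-strictlyMonotone i<j j<k 1F 2F _ = j<k
pick₃-strictlyMonotone i<j j<k 0F 0F ()
pick₃-strictlyMonotone i<j j<k 1F 0F ()
pick₃-strictlyMonotone i<j j<k 1F 1F (s≤s ())
pick₃-strictlyMonotone i<j j<k 2F 0F ()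
pick₃-strictlyMonotone i<j j<k 2F 1F (s≤s ())
pick₃-strictlyMonotone i<j j<k 2F 2F (s≤s (s≤s ()))

avoids⇒avoids231 : (τ : Permutation′ 3) → HasWord τ (wordTo1 3) → (π : Permutation′ n) → Avoids π τ → Avoids231 (π ⟨$⟩ʳ_)
avoids⇒avoids231 τ w π av i j k i<j j<k πk<πi πi<πj =
  av (occurs-intro τ π (pick₃ i j k) (pick₃-strictlyMonotone i<j j<k) λ x y → order x y ∘ subst₂ _<_ (w x) (w y))
  where
  order : ∀ x y → wordTo1 3 (toℕ x) < wordTo1 3 (toℕ y) → (π ⟨$⟩ʳ pick₃ i j k x) F.< (π ⟨$⟩ʳ pick₃ i j k y)
  order 0F 1F _ = πi<πj
  order 2F 0F _ = πk<πi
  order 2F 1F _ = <-trans πk<πi πi<πj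
  order 0F 0F (s≤s ())
  order 0F 2F ()
  order 1F 0F (s≤s ())
  order 1F 1F (s≤s (s≤s ()))
  order 1F 2F ()
  order 2F 2F ()

avoids⇒avoids312 : (τ : Permutation′ 3) → HasWord τ (wordM12 3) → (π : Permutation′ n) → Avoids π τ → Avoids312 (π ⟨$⟩ʳ_)
avoids⇒avoids312 τ w π av i j k i<j j<k πj<πk πk<πi =
  av (occurs-intro τ π (pick₃ i j k) (pick₃-strictlyMonotone i<j j<k) λ x y → order x y ∘ subst₂ _<_ (w x) (w y))
  where
  order : ∀ x y → wordM12 3 (toℕ x) < wordM12 3 (toℕ y) → (π ⟨$⟩ʳ pick₃ i j k x) F.< (π ⟨$⟩ʳ pick₃ i j k y)
  order 1F 2F _ = πj<πk
  order 1F 0F _ = <-trans πj<πk πk<πi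
  order 2F 0F _ = πk<πi
  order 0F 0F (s≤s (s≤s ()))
  order 0F 1F ()
  order 0F 2F (s≤s ())
  order 1F 1F ()
  order 2F 1F ()
  order 2F 2F (s≤s ())

-- π⁻¹ is the power π^(r-1), and it avoids 231 exactly when π avoids 312.
avoiding-powers⇒involutive : (τ : Permutation′ 3) → HasWord τ (wordTo1 3) ⊎ HasWord τ (wordM12 3) →
  (π : Permutation′ n) (k : ℕ) → (π ^ₚ (2 + k)) ≈ id → (∀ j → 1 ≤ j → Avoids (π ^ₚ j) τ) →
  (π ^ₚ 2) ≈ id
avoiding-powers⇒involutive {n} τ word π k πʳ≈id avoids = involutive word
  where
  inverse-power : ∀ i → (π ^ₚ suc k) ⟨$⟩ʳ i ≡ π ⟨$⟩ˡ i
  inverse-power i = trans (cong ((π ^ₚ suc k) ⟨$⟩ʳ_) (sym (inverseʳ π))) (πʳ≈id (π ⟨$⟩ˡ i))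
  transport : {f g : Fin n → Fin n} → (∀ i → f i ≡ g i) → ∀ {i j} → g i F.< g j → f i F.< f j
  transport eq {i} {j} = subst₂ F._<_ (sym (eq i)) (sym (eq j))
  involutive : HasWord τ (wordTo1 3) ⊎ HasWord τ (wordM12 3) → (π ^ₚ 2) ≈ id
  involutive (inj₁ w) = avoids231∧312⇒involutive π av (inverse-avoids312 (flip π) av⁻¹)
    where
    av : Avoids231 (π ⟨$⟩ʳ_)
    av = avoids⇒avoids231 τ w (π ^ₚ 1) (avoids 1 (s≤s z≤n))
    av⁻¹ : Avoids231 (π ⟨$⟩ˡ_)
    av⁻¹ x y z x<y y<z p q = avoids⇒avoids231 τ w (π ^ₚ suc k) (avoids (suc k) (s≤s z≤n)) x y z x<y y<z
      (transport inverse-power p) (transport inverse-power q)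
  involutive (inj₂ w) = avoids231∧312⇒involutive π (inverse-avoids231 (flip π) av⁻¹) av
    where
    av : Avoids312 (π ⟨$⟩ʳ_)
    av = avoids⇒avoids312 τ w (π ^ₚ 1) (avoids 1 (s≤s z≤n))
    av⁻¹ : Avoids312 (π ⟨$⟩ˡ_)
    av⁻¹ x y z x<y y<z p q = avoids⇒avoids312 τ w (π ^ₚ suc k) (avoids (suc k) (s≤s z≤n)) x y z x<y y<z
      (transport inverse-power p) (transport inverse-power q)

Ξ-231-312 : (τ : Permutation′ 3) → (HasWord τ (wordTo1 3) ⊎ HasWord τ (wordM12 3)) →
            ∀ r → Ξ τ r ⇔ (r ≡ 1 ⊎ r ≡ 2)
Ξ-231-312 τ word r = mk⇔ (to r) from
  where
  to : ∀ r → Ξ τ r → r ≡ 1 ⊎ r ≡ 2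
  to 1 _ = inj₁ refl
  to 2 _ = inj₂ refl
  -- An order of at least 3 contradicts π² = id.
  to (suc (suc (suc k))) (n , _ , π , (_ , πʳ≈id , min) , avoids) = contradiction
    (avoiding-powers⇒involutive τ word π (suc k) πʳ≈id avoids) (min 2 (s≤s z≤n) (s≤s (s≤s (s≤s z≤n))))
  to zero (_ , _ , _ , (() , _) , _)
  from : r ≡ 1 ⊎ r ≡ 2 → Ξ τ r
  -- Cycles on one or two points are too short for a pattern of length three.
  from (inj₁ refl) = 1 , s≤s z≤n , rotate , rotate-hasOrder ,
    λ j _ occ → <⇒≱ (s≤s (s≤s z≤n)) (occurs⇒≤ {τ = τ} {rotate ^ₚ j} occ)
  from (inj₂ refl) = 2 , s≤s z≤n , rotate , rotate-hasOrder ,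
    λ j _ occ → <⇒≱ (s≤s (s≤s (s≤s z≤n))) (occurs⇒≤ {τ = τ} {rotate ^ₚ j} occ)

theorem1p6 : (∀ (m : ℕ) → 2 ≤ m → (τ : Permutation′ m) →
    (HasWord τ wordId →
    ∀ r → Ξ τ r ⇔ Σ (Permutation′ (m ∸ 1)) (λ σ → HasOrder σ r))
    × ((¬ HasWord τ wordId × ¬ HasWord τ (wordM12 m) × ¬ HasWord τ (wordTo1 m)) →
    ∀ r → Ξ τ r ⇔ 1 ≤ r))
    × (∀ (τ : Permutation′ 3) → (HasWord τ (wordTo1 3) ⊎ HasWord τ (wordM12 3)) →
    ∀ r → Ξ τ r ⇔ (r ≡ 1 ⊎ r ≡ 2))
theorem1p6 = (λ m 2≤m τ → Ξ-identity 2≤m τ , Ξ-generic 2≤m τ) , Ξ-231-312
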